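{- Let $n\ge 4$ be even and let $W_n = K_1\vee C_n$ be the wheel graph. Then there are exactly $2^{\frac{n}{2}+1}-1$ switching classes of signatures of $W_n$ that maximise the frustration index (i.e. with $l(W_n,\sigma)=l_{\max}(W_n)$).
   Context: All graphs are finite, simple and undirected. A signed graph $\Sigma=(G,\sigma)$ is a graph $G$ with a signature $\sigma:E(G)\to\{+1,-1\}$. The sign of a cycle is the product of the signs of its edges; $\Sigma$ is balanced if all its cycles are positive. The frustration index $l(\Sigma)$ is the minimum number of edges whose deletion makes $\Sigma$ balanced; it is invariant under switching. $l_{\max}(G)=\max_\sigma l(G,\sigma)$. Switching $\Sigma$ at a vertex subset $X$ negates the signs of all edges with exactly one endpoint in $X$; a switching class is an equivalence class of signatures of the (labelled) graph $G$ under switching. $C_n$ is the cycle on $n$ vertices and $\vee$ denotes the join of vertex-disjoint graphs. -}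

module Defs where

open import Data.Bool.Base using (Bool; true; false; if_then_else_; _xor_)
open import Data.Bool.Properties using (xor-comm)
open import Data.Fin.Base using (Fin; toℕ)
import Data.Fin.Properties as Fin
open import Data.List.Base using (List; []; _∷_; length)
import Data.List.Membership.DecSetoid as DecMembership
import Data.List.Membership.Setoid.Properties as Membership
import Data.List.Relation.Unary.Unique.Propositional as Propositional
import Data.List.Relation.Unary.Unique.Setoid as UniqueSetoid
open import Data.Nat.Base using (ℕ; suc; _+_; _≤_; s≤s)
open import Data.Nat.Properties using (1+n≢n)
open import Data.Product.Base using (Σ; ∃; _×_; _,_; proj₁)
open import Data.Sign.Base as Sign using (Sign)
import Data.Sign.Properties as Sign
open import Data.Sum.Base as Sum using (_⊎_; inj₁; inj₂)
open import Data.Sum.Function.Propositional using (_⊎-↔_)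
open import Data.Unit.Base using (⊤; tt)
open import Function.Base using (_∘_)
open import Function.Bundles using (Func; Inverse; _↔_; _⟨$⟩_)
open import Function.Construct.Composition using (_↔-∘_)
open import Function.Construct.Identity using (↔-id)
open import Function.Construct.Symmetry using (↔-sym)
open import Function.Properties.Inverse using (↔⇒↣)
open import Level using (0ℓ)
open import Relation.Binary.Bundles using (Setoid; DecSetoid)
import Relation.Binary.Construct.On as On
open import Relation.Binary.Construct.Closure.ReflexiveTransitive using (Star; ε; _◅_)
open import Relation.Binary.Core using (Rel)
open import Relation.Binary.Definitions using (Decidable; DecidableEquality; Symmetric; Irreflexive)
open import Relation.Binary.PropositionalEquality
  using (_≡_; _≢_; refl; sym; trans; cong; cong₂; setoid)
open import Relation.Binary.Structures using (IsEquivalence)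
open import Relation.Nullary using (¬_; yes; no)
open import Relation.Nullary.Decidable using (¬?; _×-dec_; _⊎-dec_)

record Graph : Set₁ where
  infix 4 _~_ _~?_
  field
    V      : Set
    order  : ℕ
    finite : V ↔ Fin order
    _~_    : Rel V 0ℓ
    _~?_   : Decidable _~_
    ~-sym  : Symmetric _~_
    ~-irr  : Irreflexive _≡_ _~_

  _≟ⱽ_ : DecidableEquality V
  _≟ⱽ_ = Fin.inj⇒≟ (↔⇒↣ finite)

-- Each edge of G is represented by both of its orientations (and by any proof
-- of adjacency); edgeSetoid identifies them.
record Edge (G : Graph) : Set where
  constructor edge
  open Graph G
  field
    {src tgt} : V
    adjacent  : src ~ tgt

module _ (G : Graph) where
  open Graph G
  open Edge

  infix 4 _≈ₑ_
  _≈ₑ_ : Rel (Edge G) 0ℓ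
  e ≈ₑ f = (src e ≡ src f × tgt e ≡ tgt f) ⊎ (src e ≡ tgt f × tgt e ≡ src f)

  ≈ₑ-isEquivalence : IsEquivalence _≈ₑ_
  ≈ₑ-isEquivalence = record
    { refl  = inj₁ (refl , refl)
    ; sym   = λ where
        (inj₁ (refl , refl)) → inj₁ (refl , refl)
        (inj₂ (refl , refl)) → inj₂ (refl , refl)
    ; trans = λ where
        (inj₁ (refl , refl)) q                    → q
        (inj₂ (refl , refl)) (inj₁ (refl , refl)) → inj₂ (refl , refl)
        (inj₂ (refl , refl)) (inj₂ (refl , refl)) → inj₁ (refl , refl)
    }

  edgeDecSetoid : DecSetoid 0ℓ 0ℓ
  edgeDecSetoid = record
    { Carrier          = Edge G
    ; _≈_              = _≈ₑ_
    ; isDecEquivalence = record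
      { isEquivalence = ≈ₑ-isEquivalence
      ; _≟_           = λ e f →
          ((src e ≟ⱽ src f) ×-dec (tgt e ≟ⱽ tgt f)) ⊎-dec
          ((src e ≟ⱽ tgt f) ×-dec (tgt e ≟ⱽ src f))
      }
    }

  edgeSetoid : Setoid 0ℓ 0ℓ
  edgeSetoid = DecSetoid.setoid edgeDecSetoid

  open DecMembership edgeDecSetoid public using () renaming (_∉_ to _∉ₑ_; _∈?_ to _∈ₑ?_)
  open UniqueSetoid edgeSetoid public using () renaming (Unique to Uniqueₑ)

Signature : Graph → Set
Signature G = Func (edgeSetoid G) (setoid Sign)

module _ (G : Graph) (D : List (Edge G)) where
  open Graph G

  deleteEdges : Graph
  deleteEdges = record
    { V      = V
    ; order  = order
    ; finite = finite
    ; _~_    = _~ᴰ_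
    ; _~?_   = dec
    ; ~-sym  = λ (a , a∉D) → ~-sym a ,
        Membership.∉-resp-≈ (edgeSetoid G) {x = edge a} {edge (~-sym a)} (inj₂ (refl , refl)) a∉D
    ; ~-irr  = λ eq → ~-irr eq ∘ proj₁
    }
    where
    _~ᴰ_ : Rel V 0ℓ
    u ~ᴰ v = Σ (u ~ v) λ a → _∉ₑ_ G (edge a) D

    dec : Decidable _~ᴰ_
    dec u v with u ~? v
    ... | no ¬a = no (¬a ∘ proj₁)
    ... | yes a with _∈ₑ?_ G (edge a) D
    ...   | no  a∉D = yes (a , a∉D)
    ...   | yes a∈D = no λ (b , b∉D) →
      b∉D (Membership.∈-resp-≈ (edgeSetoid G) {x = edge a} {edge b} (inj₁ (refl , refl)) a∈D)

  restrict : Signature G → Signature deleteEdges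
  restrict σ = record
    { to   = λ e → σ ⟨$⟩ original e
    ; cong = λ {e} {f} → Func.cong σ {original e} {original f}
    }
    where
    original : Edge deleteEdges → Edge G
    original (edge (a , _)) = edge a

module _ {G : Graph} where
  open Graph G

  Walk : Rel V 0ℓ
  Walk = Star _~_

  -- The final vertex is left out, so that a closed walk lists its start once.
  vertices : ∀ {u v} → Walk u v → List V
  vertices ε               = []
  vertices (_◅_ {u} _ walk) = u ∷ vertices walk

  IsCycle : ∀ {v} → Walk v v → Set
  IsCycle walk = 3 ≤ length (vertices walk) × Propositional.Unique (vertices walk)

  sign : Signature G → ∀ {u v} → Walk u v → Sign
  sign σ ε          = Sign.+
  sign σ (a ◅ walk) = (σ ⟨$⟩ edge a) Sign.* sign σ walk

  Balanced : Signature G → Set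
  Balanced σ = ∀ {v} (walk : Walk v v) → IsCycle walk → sign σ walk ≡ Sign.+

IsMinimum : (ℕ → Set) → ℕ → Set
IsMinimum P m = P m × (∀ k → P k → m ≤ k)

IsMaximum : (ℕ → Set) → ℕ → Set
IsMaximum P m = P m × (∀ k → P k → k ≤ m)

module _ (G : Graph) where

  BalancedByDeleting : Signature G → ℕ → Set
  BalancedByDeleting σ k =
    ∃ λ (D : List (Edge G)) → Uniqueₑ G D × length D ≡ k × Balanced (restrict G D σ)

  IsFrustrationIndex : Signature G → ℕ → Set
  IsFrustrationIndex σ = IsMinimum (BalancedByDeleting σ)

  IsMaxFrustrationIndex : ℕ → Set
  IsMaxFrustrationIndex = IsMaximum λ k → ∃ λ σ → IsFrustrationIndex σ k

  MaximisesFrustration : Signature G → Set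
  MaximisesFrustration σ = ∃ λ k → IsFrustrationIndex σ k × IsMaxFrustrationIndex k

module _ {G : Graph} where
  open Graph G

  switch : (V → Bool) → Signature G → Signature G
  switch X σ = record
    { to   = λ e → flip (X (Edge.src e) xor X (Edge.tgt e)) (σ ⟨$⟩ e)
    ; cong = λ {e} {f} e≈f → cong₂ flip (cut e f e≈f) (Func.cong σ e≈f)
    }
    where
    flip : Bool → Sign → Sign
    flip b s = if b then Sign.opposite s else s

    cut : ∀ e f → _≈ₑ_ G e f →
          X (Edge.src e) xor X (Edge.tgt e) ≡ X (Edge.src f) xor X (Edge.tgt f)
    cut _ _ (inj₁ (refl , refl)) = refl
    cut e _ (inj₂ (refl , refl)) = xor-comm (X (Edge.src e)) (X (Edge.tgt e))

  infix 4 _≈ₛ_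
  _≈ₛ_ : Rel (Signature G) 0ℓ
  σ ≈ₛ τ = ∃ λ (X : V → Bool) → ∀ e → τ ⟨$⟩ e ≡ switch X σ ⟨$⟩ e

  ≈ₛ-isEquivalence : IsEquivalence _≈ₛ_
  ≈ₛ-isEquivalence = record
    { refl  = (λ _ → false) , λ _ → refl
    ; sym   = λ (X , τ≡) → X , λ e →
        undo (X (Edge.src e)) (X (Edge.tgt e)) (τ≡ e)
    ; trans = λ (X , τ≡) (Y , υ≡) → (λ v → X v xor Y v) , λ e →
        compose (X (Edge.src e)) (X (Edge.tgt e)) (Y (Edge.src e)) (Y (Edge.tgt e)) (τ≡ e) (υ≡ e)
    }
    where
    undo : ∀ a b {s t} → t ≡ (if a xor b then Sign.opposite s else s) →
           s ≡ (if a xor b then Sign.opposite t else t)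
    undo a b {s} refl with a xor b
    ... | false = refl
    ... | true  = sym (Sign.opposite-involutive s)

    compose : ∀ a b c d {s t u} →
              t ≡ (if a xor b then Sign.opposite s else s) →
              u ≡ (if c xor d then Sign.opposite t else t) →
              u ≡ (if (a xor c) xor (b xor d) then Sign.opposite s else s)
    compose false false false false refl refl = refl
    compose false false false true  refl refl = refl
    compose false false true  false refl refl = refl
    compose false false true  true  refl refl = refl
    compose false true  false false refl refl = refl
    compose false true  false true  {s} refl refl = Sign.opposite-involutive s
    compose false true  true  false {s} refl refl = Sign.opposite-involutive s
    compose false true  true  true  refl refl = refl
    compose true  false false false refl refl = refl
    compose true  false false true  {s} refl refl = Sign.opposite-involutive s
    compose true  false true  false {s} refl refl = Sign.opposite-involutive s
    compose true  false true  true  refl refl = refl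
    compose true  true  false false refl refl = refl
    compose true  true  false true  refl refl = refl
    compose true  true  true  false refl refl = refl
    compose true  true  true  true  refl refl = refl

switchingSetoid : Graph → Setoid 0ℓ 0ℓ
switchingSetoid G = record
  { Carrier = Signature G ; _≈_ = _≈ₛ_ ; isEquivalence = ≈ₛ-isEquivalence }

-- A switching class is an element of switchingSetoid G. Its maximising
-- classes are those of the maximising signatures, still up to switching.
maximisingClasses : Graph → Setoid 0ℓ 0ℓ
maximisingClasses G =
  On.setoid {B = ∃ (MaximisesFrustration G)} (switchingSetoid G) proj₁

HasExactly : ℕ → Setoid 0ℓ 0ℓ → Set
HasExactly k S = Inverse S (setoid (Fin k))

K : ℕ → Graph
K n = record
  { V      = Fin n
  ; order  = n
  ; finite = ↔-id (Fin n)
  ; _~_    = _≢_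
  ; _~?_   = λ i j → ¬? (i Fin.≟ j)
  ; ~-sym  = λ i≢j → i≢j ∘ sym
  ; ~-irr  = λ i≡j i≢j → i≢j i≡j
  }

-- For n < 3 the relation below does not describe a cycle: it has a loop for
-- n = 1 and a single edge for n = 2.
C : (n : ℕ) → 3 ≤ n → Graph
C n 3≤n = record
  { V      = Fin n
  ; order  = n
  ; finite = ↔-id (Fin n)
  ; _~_    = λ i j → Next i j ⊎ Next j i
  ; _~?_   = λ i j → next? i j ⊎-dec next? j i
  ; ~-sym  = Sum.swap
  ; ~-irr  = λ { refl → Sum.[ Next-irr 3≤n , Next-irr 3≤n ] }
  }
  where
  open import Data.Nat.Properties using (_≟_)

  Next : Rel (Fin n) 0ℓ
  Next i j = (toℕ j ≡ suc (toℕ i)) ⊎ (suc (toℕ i) ≡ n × toℕ j ≡ 0)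

  next? : Decidable Next
  next? i j = (toℕ j ≟ suc (toℕ i)) ⊎-dec ((suc (toℕ i) ≟ n) ×-dec (toℕ j ≟ 0))

  Next-irr : 3 ≤ n → ∀ {i} → ¬ Next i i
  Next-irr _ (inj₁ i≡1+i) = 1+n≢n (sym i≡1+i)
  Next-irr 3≤n (inj₂ (1+i≡n , i≡0)) with trans (sym (cong suc i≡0)) 1+i≡n
  Next-irr (s≤s ()) (inj₂ _) | refl

infixr 6 _∨_
_∨_ : Graph → Graph → Graph
G ∨ H = record
  { V      = G.V ⊎ H.V
  ; order  = G.order + H.order
  ; finite = ↔-sym Fin.+↔⊎ ↔-∘ (G.finite ⊎-↔ H.finite)
  ; _~_    = _~_
  ; _~?_   = dec
  ; ~-sym  = λ {u} {v} → symmetric u v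
  ; ~-irr  = λ {u} → λ { refl → irreflexive u }
  }
  where
  module G = Graph G
  module H = Graph H

  _~_ : Rel (G.V ⊎ H.V) 0ℓ
  inj₁ u ~ inj₁ v = u G.~ v
  inj₂ u ~ inj₂ v = u H.~ v
  inj₁ _ ~ inj₂ _ = ⊤
  inj₂ _ ~ inj₁ _ = ⊤

  dec : Decidable _~_
  dec (inj₁ u) (inj₁ v) = u G.~? v
  dec (inj₂ u) (inj₂ v) = u H.~? v
  dec (inj₁ _) (inj₂ _) = yes tt
  dec (inj₂ _) (inj₁ _) = yes tt

  symmetric : ∀ u v → u ~ v → v ~ u
  symmetric (inj₁ _) (inj₁ _) = G.~-sym
  symmetric (inj₂ _) (inj₂ _) = H.~-sym
  symmetric (inj₁ _) (inj₂ _) = λ _ → tt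
  symmetric (inj₂ _) (inj₁ _) = λ _ → tt

  irreflexive : ∀ u → ¬ (u ~ u)
  irreflexive (inj₁ _) = G.~-irr refl
  irreflexive (inj₂ _) = H.~-irr refl

W : (n : ℕ) → 3 ≤ n → Graph
W n 3≤n = K 1 ∨ C n 3≤n

{-# OPTIONS --safe #-}
module Submission where

-- Up to switching, a signature of the wheel is determined by the signs of its n
-- triangles (hub, v, v+1), and these can be prescribed freely. If all the even
-- triangles, or all the odd ones, are negative, then deletion must meet n/2
-- edge-disjoint negative cycles. Conversely, two neighbouring triangles can
-- always be made positive at the cost of one edge, their common spoke or one of their rim
-- edges; pairing all triangles gives the upper bound n/2. If there are a positive even
-- and a positive odd triangle, these can be left out of the pairing, which saves
-- one edge. So the maximising classes correspond to pairs of sign vectors of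
-- length n/2 of which at least one is constantly negative: 2 * 2^(n/2) - 1 of them.

open import Defs
open import Data.Bool.Base using (Bool; true; false; not; _∧_; if_then_else_)
open import Data.Empty using (⊥-elim)
open import Data.Fin.Base as Fin
  using (Fin; zero; suc; toℕ; fromℕ<; fromℕ; inject₁; combine; remQuot; punchIn; punchOut)
import Data.Fin.Properties as Fin
open import Data.List.Base as List using (List; []; _∷_; length; map; deduplicate; allFin)
import Data.List.Properties as List
open import Data.List.Membership.Propositional using (_∈_)
open import Data.List.Membership.Propositional.Properties using (∈-map⁺; ∈-allFin)
import Data.List.Membership.Setoid as SetoidMembership
import Data.List.Membership.Setoid.Properties as SetoidMembershipₚ
open import Data.List.Relation.Unary.All using ([]; _∷_)
open import Data.List.Relation.Unary.AllPairs using ([]; _∷_)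
open import Data.List.Relation.Unary.Any as Any using (index)
open import Data.List.Relation.Unary.Any.Properties using (lookup-index)
open import Data.List.Relation.Unary.Unique.DecSetoid.Properties using (deduplicate-!)
open import Data.Nat.Base as ℕ using (ℕ; zero; suc; _≤_; _<_; z≤n; s≤s; _+_; _*_; _∸_; _^_)
open import Data.Nat.DivMod using (_/_; m*n/n≡m)
open import Data.Nat.Divisibility using (_∣_; divides)
import Data.Nat.Properties as ℕ
open import Data.Nat.Properties using (<⇒≤)
open import Data.Product.Base using (∃; _×_; _,_; proj₁; proj₂; map₂)
open import Data.Sign.Base as Sign using (Sign)
import Data.Sign.Properties as Sign
open import Data.Sum.Base as Sum using (_⊎_; inj₁; inj₂; [_,_]′)
open import Data.Sum.Properties using (inj₂-injective)
open import Data.Unit.Base using (tt)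
open import Function.Base using (_∘_; const; case_of_)
open import Function.Bundles using (Func; _⟨$⟩_)
open import Function.Definitions using (Injective)
open import Relation.Binary.Bundles using (Setoid; DecSetoid)
open import Relation.Binary.Construct.Closure.ReflexiveTransitive using (ε; _◅_)
open import Relation.Binary.PropositionalEquality
  using (_≡_; _≢_; refl; sym; trans; cong; cong₂; subst)
open import Relation.Nullary using (¬_; Dec; yes; no; does)
open import Relation.Nullary.Decidable using (map′; _×-dec_; _⊎-dec_; _→-dec_; True; toWitness)

-- Deciding identities between signs by exhaustive evaluation.

module SignIdentities where

  instance
    ≡-dec : ∀ {a b : Sign} → Dec (a ≡ b)
    ≡-dec = _ Sign.≟ _

    ⇒-dec : ∀ {a b : Sign} {P : Set} → ⦃ Dec P ⦄ → Dec (a ≡ b → P)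
    ⇒-dec ⦃ P? ⦄ = (_ Sign.≟ _) →-dec P?

    ∀-dec : ∀ {P : Sign → Set} → ⦃ ∀ {s} → Dec (P s) ⦄ → Dec (∀ s → P s)
    ∀-dec ⦃ P? ⦄ = map′ (λ (p , q) → λ { Sign.+ → p ; Sign.- → q })
                        (λ f → f Sign.+ , f Sign.-)
                        (P? ×-dec P?)

  -- The instances above decide any nesting of quantifiers over signs, implications and equations;
  -- the implicit argument is then solved by evaluating that decision.
  byCases : ∀ {P : Set} → ⦃ P? : Dec P ⦄ → {True P?} → P
  byCases {_} ⦃ P? ⦄ {holds} = toWitness holds

open SignIdentities

toSign : Bool → Sign
toSign true  = Sign.-
toSign false = Sign.+

isNegative : Sign → Bool
isNegative Sign.- = true
isNegative Sign.+ = false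

≢-⇒≡+ : ∀ {s} → s ≢ Sign.- → s ≡ Sign.+
≢-⇒≡+ {Sign.+} _   = refl
≢-⇒≡+ {Sign.-} s≢- = ⊥-elim (s≢- refl)

-- Switching and balance in terms of potentials.

module _ {G : Graph} where
  open Graph G
  open Edge

  -- A switching set is recast as a sign-valued potential on the vertices, so that switching becomes
  -- multiplication by a coboundary and is open to sign algebra.
  potential⇒≈ₛ : ∀ {σ τ : Signature G} (y : V → Sign) →
    (∀ e → τ ⟨$⟩ e ≡ y (src e) Sign.* y (tgt e) Sign.* (σ ⟨$⟩ e)) → σ ≈ₛ τ
  potential⇒≈ₛ {σ} {τ} y eq = isNegative ∘ y , step
    where
    step : ∀ e → τ ⟨$⟩ e ≡ switch (isNegative ∘ y) σ ⟨$⟩ e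
    step e with τ ⟨$⟩ e | σ ⟨$⟩ e | y (src e) | y (tgt e) | eq e
    ... | _ | _ | Sign.- | Sign.- | refl = Sign.*-identityˡ _
    ... | _ | _ | Sign.- | Sign.+ | refl = refl
    ... | _ | _ | Sign.+ | Sign.- | refl = refl
    ... | _ | _ | Sign.+ | Sign.+ | refl = refl

  ≈ₛ⇒potential : ∀ {σ τ : Signature G} → σ ≈ₛ τ →
    ∃ λ y → ∀ e → τ ⟨$⟩ e ≡ y (src e) Sign.* y (tgt e) Sign.* (σ ⟨$⟩ e)
  ≈ₛ⇒potential {σ} {τ} (X , eq) = toSign ∘ X , step
    where
    step : ∀ e → τ ⟨$⟩ e ≡ toSign (X (src e)) Sign.* toSign (X (tgt e)) Sign.* (σ ⟨$⟩ e)
    step e with τ ⟨$⟩ e | σ ⟨$⟩ e | X (src e) | X (tgt e) | eq e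
    ... | _ | _ | true  | true  | refl = refl
    ... | _ | _ | true  | false | refl = refl
    ... | _ | _ | false | true  | refl = refl
    ... | _ | _ | false | false | refl = refl

  -- The product of a coboundary along a walk telescopes to its two ends; closed walks are therefore
  -- positive.
  sign-potential : (σ : Signature G) (y : V → Sign) →
    (∀ e → σ ⟨$⟩ e ≡ y (src e) Sign.* y (tgt e)) →
    ∀ {u v} (walk : Walk {G} u v) → sign {G} σ walk ≡ y u Sign.* y v
  sign-potential σ y eq {u} ε = sym (Sign.s*s≡+ (y u))
  sign-potential σ y eq {u} {v} (_◅_ {j = w} a walk)
    rewrite eq (edge a) | sign-potential σ y eq walk = telescope (y u) (y w) (y v)
    where
    telescope : ∀ a b c → (a Sign.* b) Sign.* (b Sign.* c) ≡ a Sign.* c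
    telescope = byCases

module _ (G : Graph) where
  open Graph G
  open Edge
  open SetoidMembership (edgeSetoid G) using () renaming (_∈_ to _∈ₑ_)

  -- A potential whose coboundary agrees with `σ` off `D` certifies balance. `D` may list an edge
  -- twice or in both orientations, so deduplication leaves only an inequality for the number of
  -- edges.
  balancedByDeleting : (σ : Signature G) (D : List (Edge G)) (y : V → Sign) →
    (∀ e → (σ ⟨$⟩ e ≡ y (src e) Sign.* y (tgt e)) ⊎ e ∈ₑ D) →
    ∃ λ k → k ≤ length D × BalancedByDeleting G σ k
  balancedByDeleting σ D y off =
    length D′ , List.length-deduplicate _≟ₑ_ D ,
    D′ , deduplicate-! (edgeDecSetoid G) D , refl ,
    λ {v} walk _ → trans (sign-potential (restrict G D′ σ) y off′ walk) (Sign.s*s≡+ (y v))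
    where
    open DecSetoid (edgeDecSetoid G) using () renaming (_≟_ to _≟ₑ_; trans to ≈-trans; sym to ≈-sym)
    D′ : List (Edge G)
    D′ = deduplicate _≟ₑ_ D
    off′ : ∀ e → restrict G D′ σ ⟨$⟩ e ≡ y (src e) Sign.* y (tgt e)
    off′ (edge (a , a∉D′)) with off (edge a)
    ... | inj₁ eq  = eq
    ... | inj₂ a∈D = ⊥-elim (a∉D′
      (SetoidMembershipₚ.∈-deduplicate⁺ (edgeSetoid G) _≟ₑ_
        (λ {x} {y} {z} p q → ≈-trans {x} {y} {z} q (≈-sym {z} {y} p))
        {xs = D} {z = edge a} a∈D))

-- The cyclic successor on `Fin n`.

Successor : (n : ℕ) → Fin n → Fin n → Set
Successor n i j = (toℕ j ≡ suc (toℕ i)) ⊎ (suc (toℕ i) ≡ n × toℕ j ≡ 0)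

module _ {n : ℕ} where

  Successor-functional : ∀ {i j j′} → Successor n i j → Successor n i j′ → j ≡ j′
  Successor-functional (inj₁ p)       (inj₁ q)       = Fin.toℕ-injective (trans p (sym q))
  Successor-functional (inj₂ (_ , p)) (inj₂ (_ , q)) = Fin.toℕ-injective (trans p (sym q))
  Successor-functional {j = j} (inj₁ p) (inj₂ (q , _)) =
    ⊥-elim (ℕ.<⇒≢ (Fin.toℕ<n j) (trans p q))
  Successor-functional {j′ = j} (inj₂ (q , _)) (inj₁ p) =
    ⊥-elim (ℕ.<⇒≢ (Fin.toℕ<n j) (trans p q))

  Successor-injective : ∀ {i i′ j} → Successor n i j → Successor n i′ j → i ≡ i′
  Successor-injective (inj₁ p) (inj₁ q) =
    Fin.toℕ-injective (ℕ.suc-injective (trans (sym p) q))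
  Successor-injective (inj₂ (p , _)) (inj₂ (q , _)) =
    Fin.toℕ-injective (ℕ.suc-injective (trans p (sym q)))
  Successor-injective (inj₁ p) (inj₂ (_ , q)) = case trans (sym p) q of λ ()
  Successor-injective (inj₂ (_ , q)) (inj₁ p) = case trans (sym p) q of λ ()

  -- Two successor steps return to the start only if n is at most 2. This keeps two rim edges from
  -- being each other's reversal.
  Successor-asym : 3 ≤ n → ∀ {i j} → Successor n i j → ¬ Successor n j i
  Successor-asym _ {i} (inj₁ p) (inj₁ q) =
    ℕ.<⇒≢ (ℕ.m<n⇒m<1+n (ℕ.n<1+n (toℕ i))) (trans q (cong suc p))
  Successor-asym 3≤n (inj₁ p) (inj₂ (q , r)) rewrite p | r = case subst (3 ≤_) (sym q) 3≤n of λ { (s≤s (s≤s ())) }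
  Successor-asym 3≤n (inj₂ (q , r)) (inj₁ p) rewrite r | p = case subst (3 ≤_) (sym q) 3≤n of λ { (s≤s (s≤s ())) }
  Successor-asym 3≤n (inj₂ (q , _)) (inj₂ (_ , r)) rewrite r = case subst (3 ≤_) (sym q) 3≤n of λ { (s≤s ()) }

module _ {k : ℕ} where

  abstract
    -- Kept opaque: later arguments use `next` only through `next-Successor`.
    next : Fin (suc k) → Fin (suc k)
    next i with suc (toℕ i) ℕ.<? suc k
    ... | yes 1+i<n = fromℕ< 1+i<n
    ... | no  _     = zero

    next-Successor : ∀ i → Successor (suc k) i (next i)
    next-Successor i with suc (toℕ i) ℕ.<? suc k
    ... | yes 1+i<n = inj₁ (Fin.toℕ-fromℕ< 1+i<n)
    ... | no  1+i≮n = inj₂ (ℕ.≤-antisym (Fin.toℕ<n i) (ℕ.≮⇒≥ 1+i≮n) , refl)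

  next-injective : Injective _≡_ _≡_ next
  next-injective {i} {j} eq =
    Successor-injective (next-Successor i) (subst (Successor _ j) (sym eq) (next-Successor j))

  prev : Fin (suc k) → Fin (suc k)
  prev zero    = fromℕ k
  prev (suc i) = inject₁ i

  prev-Successor : ∀ i → Successor (suc k) (prev i) i
  prev-Successor zero    = inj₂ (cong suc (Fin.toℕ-fromℕ k) , refl)
  prev-Successor (suc i) = inj₁ (cong suc (sym (Fin.toℕ-inject₁ i)))

  prev-next : ∀ i → prev (next i) ≡ i
  prev-next i = Successor-injective (prev-Successor (next i)) (next-Successor i)

-- The wheel: its edges, and its switching classes as triangle sign vectors.

module Wheel {k : ℕ} (3≤n : 3 ≤ suc k) where

  G : Graph
  G = W (suc k) 3≤n

  open Graph G using (V)
  open Edge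
  open Setoid (edgeSetoid G) using (_≈_)
    renaming (refl to ≈-refl; sym to ≈-sym; trans to ≈-trans)
  open SetoidMembership (edgeSetoid G) using () renaming (_∈_ to _∈ₑ_)

  pattern hub = inj₁ zero

  spoke : Fin (suc k) → Edge G
  spoke v = edge {src = hub} {tgt = inj₂ v} tt

  rim : Fin (suc k) → Edge G
  rim v = edge {src = inj₂ v} {tgt = inj₂ (next v)} (inj₁ (next-Successor v))

  classify : (e : Edge G) → (∃ λ v → e ≈ spoke v) ⊎ (∃ λ v → e ≈ rim v)
  classify (edge {hub}    {hub}    0≢0)      = ⊥-elim (0≢0 refl)
  classify (edge {hub}    {inj₂ v} _)        = inj₁ (v , inj₁ (refl , refl))
  classify (edge {inj₂ v} {hub}    _)        = inj₁ (v , inj₂ (refl , refl))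
  classify (edge {inj₂ u} {inj₂ v} (inj₁ s)) =
    inj₂ (u , inj₁ (refl , cong inj₂ (Successor-functional s (next-Successor u))))
  classify (edge {inj₂ u} {inj₂ v} (inj₂ s)) =
    inj₂ (v , inj₂ (cong inj₂ (Successor-functional s (next-Successor v)) , refl))

  rim-injective : ∀ {u v} → rim u ≈ rim v → u ≡ v
  rim-injective (inj₁ (p , _)) = inj₂-injective p
  rim-injective {u} {v} (inj₂ (p , q)) = ⊥-elim (Successor-asym 3≤n
    (subst (Successor _ u) (inj₂-injective q) (next-Successor u))
    (subst (Successor _ v) (sym (inj₂-injective p)) (next-Successor v)))

  spoke≉rim : ∀ {u v} → ¬ (spoke u ≈ rim v)
  spoke≉rim (inj₁ (() , _))
  spoke≉rim (inj₂ (() , _))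

  triangleSign : Signature G → Fin (suc k) → Sign
  triangleSign σ v = (σ ⟨$⟩ spoke v) Sign.* (σ ⟨$⟩ rim v) Sign.* (σ ⟨$⟩ spoke (next v))

  -- All spokes are positive, so each triangle gets the sign of its rim edge. That spokes and rim
  -- edges are told apart, and rim edges from each other, makes the value respect `≈`.
  fromTriangleSigns : (Fin (suc k) → Sign) → Signature G
  fromTriangleSigns t = record { to = λ e → value e (classify e) ; cong = λ {e} {f} → resp {e} {f} }
    where
    value : ∀ e → (∃ λ v → e ≈ spoke v) ⊎ (∃ λ v → e ≈ rim v) → Sign
    value _ = [ const Sign.+ , t ∘ proj₁ ]′
    resp : ∀ {e f} → e ≈ f → value e (classify e) ≡ value f (classify f)
    resp {e} {f} e≈f with classify e | classify f
    ... | inj₁ _       | inj₁ _       = refl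
    ... | inj₁ (u , p) | inj₂ (v , q) = ⊥-elim (spoke≉rim {u} {v}
      (≈-trans {spoke u} {e} {rim v} (≈-sym {e} {spoke u} p) (≈-trans {e} {f} {rim v} e≈f q)))
    ... | inj₂ (u , p) | inj₁ (v , q) = ⊥-elim (spoke≉rim {v} {u}
      (≈-trans {spoke v} {f} {rim u} (≈-sym {f} {spoke v} q)
        (≈-trans {f} {e} {rim u} (≈-sym {e} {f} e≈f) p)))
    ... | inj₂ (u , p) | inj₂ (v , q) = cong t (rim-injective
      (≈-trans {rim u} {e} {rim v} (≈-sym {e} {rim u} p) (≈-trans {e} {f} {rim v} e≈f q)))

  triangleSign-fromTriangleSigns : ∀ t v → triangleSign (fromTriangleSigns t) v ≡ t v
  triangleSign-fromTriangleSigns t v = Sign.*-identityʳ (t v)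

  -- Each vertex of a triangle lies on two of its edges, so its potential cancels.
  triangleSign-cong : ∀ {σ τ} → σ ≈ₛ τ → ∀ v → triangleSign σ v ≡ triangleSign τ v
  triangleSign-cong {σ} {τ} σ≈τ v with y , eq ← ≈ₛ⇒potential {σ = σ} {τ} σ≈τ
    rewrite eq (spoke v) | eq (rim v) | eq (spoke (next v)) =
    cancel (y hub) (y (inj₂ v)) (y (inj₂ (next v))) _ _ _
    where
    cancel : ∀ h u v a b c → a Sign.* b Sign.* c ≡
      (h Sign.* u Sign.* a) Sign.* (u Sign.* v Sign.* b) Sign.* (h Sign.* v Sign.* c)
    cancel = byCases

  private
    onEdges : ∀ {p} (P : Edge G → Set p) → (∀ {e f} → e ≈ f → P f → P e) →
              (∀ v → P (spoke v)) → (∀ v → P (rim v)) → ∀ e → P e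
    onEdges P resp ps pr e with classify e
    ... | inj₁ (v , p) = resp {e} {spoke v} p (ps v)
    ... | inj₂ (v , p) = resp {e} {rim v} p (pr v)

    coboundary-cong : ∀ (y : V → Sign) {e f} → e ≈ f →
      y (src e) Sign.* y (tgt e) ≡ y (src f) Sign.* y (tgt f)
    coboundary-cong y (inj₁ (refl , refl)) = refl
    coboundary-cong y {e} (inj₂ (refl , refl)) = Sign.*-comm (y (src e)) (y (tgt e))

  -- With the hub fixed, the potential at a rim vertex is chosen to match the spokes there; equal
  -- triangle signs then force the rim edges to match.
  triangleSign-injective : ∀ {σ τ} → (∀ v → triangleSign σ v ≡ triangleSign τ v) → σ ≈ₛ τ
  triangleSign-injective {σ} {τ} eq = potential⇒≈ₛ {σ = σ} {τ} y
    (onEdges (λ e → τ ⟨$⟩ e ≡ y (src e) Sign.* y (tgt e) Sign.* (σ ⟨$⟩ e)) resp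
      (λ v → spokes (σ ⟨$⟩ spoke v) (τ ⟨$⟩ spoke v))
      (λ v → rims (σ ⟨$⟩ spoke v) _ (σ ⟨$⟩ spoke (next v)) (τ ⟨$⟩ spoke v) _ _ (eq v)))
    where
    y : V → Sign
    y (inj₁ _) = Sign.+
    y (inj₂ v) = (σ ⟨$⟩ spoke v) Sign.* (τ ⟨$⟩ spoke v)
    resp : ∀ {e f} → e ≈ f →
      τ ⟨$⟩ f ≡ y (src f) Sign.* y (tgt f) Sign.* (σ ⟨$⟩ f) →
      τ ⟨$⟩ e ≡ y (src e) Sign.* y (tgt e) Sign.* (σ ⟨$⟩ e)
    resp {e} {f} e≈f q = trans (Func.cong τ {e} {f} e≈f) (trans q
      (sym (cong₂ Sign._*_ (coboundary-cong y {e} {f} e≈f) (Func.cong σ {e} {f} e≈f))))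
    spokes : ∀ a b → b ≡ a Sign.* b Sign.* a
    spokes = byCases
    rims : ∀ a b c a′ b′ c′ → a Sign.* b Sign.* c ≡ a′ Sign.* b′ Sign.* c′ →
           b′ ≡ (a Sign.* a′) Sign.* (c Sign.* c′) Sign.* b
    rims = byCases

  -- Lower bound: disjoint negative triangles.

  InTriangle : Fin (suc k) → Edge G → Set
  InTriangle v e = e ≡ spoke v ⊎ e ≡ rim v ⊎ e ≡ spoke (next v)

  -- Only rim vertices are recorded: the hub lies on every triangle and cannot tell them apart.
  Incident : Fin (suc k) → Edge G → Set
  Incident w e = src e ≡ inj₂ w ⊎ tgt e ≡ inj₂ w

  Incident-resp-≈ : ∀ {w e f} → e ≈ f → Incident w e → Incident w f
  Incident-resp-≈ (inj₁ (refl , refl)) i        = i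
  Incident-resp-≈ (inj₂ (refl , refl)) (inj₁ p) = inj₂ p
  Incident-resp-≈ (inj₂ (refl , refl)) (inj₂ p) = inj₁ p

  InTriangle⇒Incident : ∀ {v e} → InTriangle v e → ∃ λ w → Incident w e
  InTriangle⇒Incident {v} (inj₁ refl)        = v , inj₂ refl
  InTriangle⇒Incident {v} (inj₂ (inj₁ refl)) = v , inj₁ refl
  InTriangle⇒Incident {v} (inj₂ (inj₂ refl)) = next v , inj₂ refl

  Incident-InTriangle : ∀ {v w e} → InTriangle v e → Incident w e → w ≡ v ⊎ w ≡ next v
  Incident-InTriangle (inj₁ refl)        (inj₂ refl) = inj₁ refl
  Incident-InTriangle (inj₂ (inj₁ refl)) (inj₁ refl) = inj₁ refl
  Incident-InTriangle (inj₂ (inj₁ refl)) (inj₂ refl) = inj₂ refl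
  Incident-InTriangle (inj₂ (inj₂ refl)) (inj₂ refl) = inj₂ refl

  module _ (σ : Signature G) (D : List (Edge G)) (balanced : Balanced (restrict G D σ)) where

    -- A triangle with no deleted edge would survive as a cycle of the balanced graph and so be
    -- positive.
    negativeTriangle-meets : ∀ v → triangleSign σ v ≡ Sign.- →
      ∃ λ e → InTriangle v e × e ∈ₑ D
    negativeTriangle-meets v negative
      with _∈ₑ?_ G (spoke v) D | _∈ₑ?_ G (rim v) D | _∈ₑ?_ G (spoke (next v)) D
    ... | yes p | _     | _     = spoke v , inj₁ refl , p
    ... | no  _ | yes q | _     = rim v , inj₂ (inj₁ refl) , q
    ... | no  _ | no  _ | yes r = spoke (next v) , inj₂ (inj₂ refl) , r
    ... | no ¬p | no ¬q | no ¬r = case trans (sym positive) negative of λ ()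
      where
      -- The closing step of the walk traverses the second spoke towards the hub, so it is only `≈`
      -- to `spoke (next v)`.
      back : Edge G
      back = edge {src = inj₂ (next v)} {tgt = hub} tt
      back≈spoke : back ≈ spoke (next v)
      back≈spoke = inj₂ (refl , refl)
      ¬r′ : ¬ (back ∈ₑ D)
      ¬r′ r = ¬r (SetoidMembershipₚ.∈-resp-≈ (edgeSetoid G) {x = back} {spoke (next v)} back≈spoke r)
      walk : Walk {deleteEdges G D} hub hub
      walk = _◅_ {j = inj₂ v} (tt , ¬p)
        (_◅_ {j = inj₂ (next v)} (inj₁ (next-Successor v) , ¬q) ((tt , ¬r′) ◅ ε))
      v≢next : v ≢ next v
      v≢next eq = Graph.~-irr G {inj₂ v} {inj₂ (next v)} (cong inj₂ eq) (inj₁ (next-Successor v))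
      isCycle : IsCycle {deleteEdges G D} walk
      isCycle = s≤s (s≤s (s≤s z≤n)) ,
        ((λ ()) ∷ (λ ()) ∷ []) ∷ ((v≢next ∘ inj₂-injective) ∷ []) ∷ [] ∷ []
      positive : triangleSign σ v ≡ Sign.+
      positive = trans
        (trans (cong ((σ ⟨$⟩ spoke v) Sign.* (σ ⟨$⟩ rim v) Sign.*_)
                     (sym (trans (Sign.*-identityʳ _) (Func.cong σ {back} {spoke (next v)} back≈spoke))))
               (Sign.*-assoc (σ ⟨$⟩ spoke v) (σ ⟨$⟩ rim v) _))
        (balanced walk isCycle)

    -- Every edge of a triangle has a rim endpoint, so triangles without a common rim vertex share
    -- no edge. Sending each to the position in `D` of a deleted edge on it is then injective.
    disjointNegativeTriangles⇒≤ : ∀ {m} (a : Fin m → Fin (suc k)) → Injective _≡_ _≡_ a →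
      (∀ i j → a i ≢ next (a j)) → (∀ i → triangleSign σ (a i) ≡ Sign.-) → m ≤ length D
    disjointNegativeTriangles⇒≤ a a-injective a≢next negative = Fin.injective⇒≤ {f = position} position-injective
      where
      meets : ∀ i → ∃ λ e → InTriangle (a i) e × e ∈ₑ D
      meets i = negativeTriangle-meets (a i) (negative i)
      position : Fin _ → Fin (length D)
      position i = index (proj₂ (proj₂ (meets i)))
      share : ∀ {i j w} → w ≡ a i ⊎ w ≡ next (a i) → w ≡ a j ⊎ w ≡ next (a j) → i ≡ j
      share (inj₁ p) (inj₁ q) = a-injective (trans (sym p) q)
      share (inj₁ p) (inj₂ q) = ⊥-elim (a≢next _ _ (trans (sym p) q))
      share (inj₂ p) (inj₁ q) = ⊥-elim (a≢next _ _ (trans (sym q) p))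
      share (inj₂ p) (inj₂ q) = a-injective (next-injective (trans (sym p) q))
      position-injective : Injective _≡_ _≡_ position
      position-injective {i} {j} eq
        with e , e∈i , e∈D ← meets i | f , f∈j , f∈D ← meets j
        with w , w∈e ← InTriangle⇒Incident e∈i =
        share (Incident-InTriangle e∈i w∈e)
              (Incident-InTriangle f∈j (Incident-resp-≈ {e = e} {f} e≈f w∈e))
        where
        e≈f : e ≈ f
        e≈f = ≈-trans {e} {List.lookup D (index f∈D)} {f}
          (subst (λ l → e ≈ List.lookup D l) eq (lookup-index e∈D))
          (≈-sym {f} {List.lookup D (index f∈D)} (lookup-index f∈D))

  -- Upper bound: explicit deletion sets.

  module _ (σ : Signature G) where

    private
      t : Fin (suc k) → Sign
      t = triangleSign σ

    -- x v is the sign of the spoke at v after switching; t v then equals the product of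
    -- the signs of the other two edges of its triangle unless the rim edge stays negative.
    deletingNegatives : (x : Fin (suc k) → Sign) (D : List (Edge G)) →
      (∀ v → x v ≡ Sign.+ ⊎ spoke v ∈ D) →
      (∀ v → t v ≡ x v Sign.* x (next v) ⊎ rim v ∈ D) →
      ∃ λ l → l ≤ length D × BalancedByDeleting G σ l
    deletingNegatives x D spokes rims = balancedByDeleting G σ D y
      (onEdges (λ e → (σ ⟨$⟩ e ≡ y (src e) Sign.* y (tgt e)) ⊎ e ∈ₑ D) resp onSpokes onRims)
      where
      -- With this potential the spoke at `v` agrees with the coboundary exactly if `x v` is
      -- positive, and the rim edge exactly if `t v` is the product of `x v` and `x (next v)`.
      y : V → Sign
      y (inj₁ _) = Sign.+
      y (inj₂ v) = (σ ⟨$⟩ spoke v) Sign.* x v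
      ∈⇒∈ₑ : ∀ {e} → e ∈ D → e ∈ₑ D
      ∈⇒∈ₑ = Any.map λ { refl → inj₁ (refl , refl) }
      resp : ∀ {e f} → e ≈ f →
        (σ ⟨$⟩ f ≡ y (src f) Sign.* y (tgt f)) ⊎ f ∈ₑ D →
        (σ ⟨$⟩ e ≡ y (src e) Sign.* y (tgt e)) ⊎ e ∈ₑ D
      resp {e} {f} e≈f (inj₁ q) = inj₁ (trans (Func.cong σ {e} {f} e≈f)
        (trans q (sym (coboundary-cong y {e} {f} e≈f))))
      resp {e} {f} e≈f (inj₂ f∈D) = inj₂
        (SetoidMembershipₚ.∈-resp-≈ (edgeSetoid G) {x = f} {e} (≈-sym {e} {f} e≈f) f∈D)
      onSpokes : ∀ v → (σ ⟨$⟩ spoke v ≡ (σ ⟨$⟩ spoke v) Sign.* x v) ⊎ spoke v ∈ₑ D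
      onSpokes v with spokes v
      ... | inj₁ xv≡+ rewrite xv≡+ = inj₁ (sym (Sign.*-identityʳ _))
      ... | inj₂ v∈D  = inj₂ (∈⇒∈ₑ v∈D)
      solve : ∀ a b c p q → a Sign.* b Sign.* c ≡ p Sign.* q → b ≡ (a Sign.* p) Sign.* (c Sign.* q)
      solve = byCases
      onRims : ∀ v → (σ ⟨$⟩ rim v ≡ y (inj₂ v) Sign.* y (inj₂ (next v))) ⊎ rim v ∈ₑ D
      onRims v with rims v
      ... | inj₁ eq  = inj₁ (solve (σ ⟨$⟩ spoke v) _ (σ ⟨$⟩ spoke (next v)) (x v) _ eq)
      ... | inj₂ v∈D = inj₂ (∈⇒∈ₑ v∈D)

    -- The two triangles at a rim vertex v of M cost one edge: their common spoke if both
    -- are negative, and the rim edge of the negative one if there is just one.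
    deletingAt : (M : Fin (suc k) → Bool) (L : List (Fin (suc k))) →
      (∀ v → M v ≡ true → v ∈ L) →
      (∀ v → M (next v) ≡ not (M v) ⊎ (M v ≡ false × M (next v) ≡ false × t v ≡ Sign.+)) →
      ∃ λ l → l ≤ length L × BalancedByDeleting G σ l
    deletingAt M L M⊆L alternates =
      subst (λ b → ∃ λ l → l ≤ b × BalancedByDeleting G σ l) (List.length-map cut L)
        (deletingNegatives x (map cut L) spokes rims)
      where
      spokeSign : Bool → Sign → Sign → Sign
      spokeSign true Sign.- Sign.- = Sign.-
      spokeSign _    _      _      = Sign.+
      x : Fin (suc k) → Sign
      x v = spokeSign (M v) (t (prev v)) (t v)
      choose : Fin (suc k) → Sign → Sign → Edge G
      choose v Sign.- Sign.- = spoke v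
      choose v Sign.- Sign.+ = rim (prev v)
      choose v Sign.+ _      = rim v
      cut : Fin (suc k) → Edge G
      cut v = choose v (t (prev v)) (t v)
      cut∈ : ∀ v → M v ≡ true → cut v ∈ map cut L
      cut∈ v Mv = ∈-map⁺ cut (M⊆L v Mv)
      spokes : ∀ v → x v ≡ Sign.+ ⊎ spoke v ∈ map cut L
      spokes v with M v | t (prev v) | t v | cut∈ v
      ... | false | _      | _      | _ = inj₁ refl
      ... | true  | Sign.+ | _      | _ = inj₁ refl
      ... | true  | Sign.- | Sign.+ | _ = inj₁ refl
      ... | true  | Sign.- | Sign.- | c = inj₂ (c refl)
      rims : ∀ v → t v ≡ x v Sign.* x (next v) ⊎ rim v ∈ map cut L
      rims v = rimCase (M v) (M (next v)) (t (prev v)) (t (next v)) (prev-next v) (cong t (prev-next v))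
        (cut∈ v) (cut∈ (next v)) (alternates v)
        where
        -- If membership alternates, exactly one end of the rim edge is in `M`, and the edge chosen
        -- there settles the triangle. The last clause is a positive triangle with neither end in
        -- `M`, which needs no deletion.
        rimCase : ∀ a b p q {s s′ u w} → prev w ≡ u → s′ ≡ s →
          (a ≡ true → choose u p s ∈ map cut L) → (b ≡ true → choose w s′ q ∈ map cut L) →
          b ≡ not a ⊎ (a ≡ false × b ≡ false × s ≡ Sign.+) →
          s ≡ spokeSign a p s Sign.* spokeSign b s′ q ⊎ rim u ∈ map cut L
        rimCase true  _ Sign.- _      {Sign.-} refl refl _ _ (inj₁ refl) = inj₁ refl
        rimCase true  _ Sign.- _      {Sign.+} refl refl _ _ (inj₁ refl) = inj₁ refl
        rimCase true  _ Sign.+ _      {Sign.-} refl refl c _ (inj₁ refl) = inj₂ (c refl)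
        rimCase true  _ Sign.+ _      {Sign.+} refl refl _ _ (inj₁ refl) = inj₁ refl
        rimCase false _ _      Sign.- {Sign.-} refl refl _ _ (inj₁ refl) = inj₁ refl
        rimCase false _ _      Sign.+ {Sign.-} refl refl _ c (inj₁ refl) = inj₂ (c refl)
        rimCase false _ _      _      {Sign.+} refl refl _ _ (inj₁ refl) = inj₁ refl
        rimCase _     _ _      _      refl refl _ _ (inj₂ (refl , refl , refl)) = inj₁ refl

-- Arcs in the cyclic order.

module _ {n : ℕ} where

  -- The positions j with a ≤ j ≤ b in the cyclic order of Fin n.
  Arc : Fin n → Fin n → Fin n → Set
  Arc a b j = (a Fin.≤ b × a Fin.≤ j × j Fin.≤ b) ⊎ (b Fin.< a × (a Fin.≤ j ⊎ j Fin.≤ b))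

  -- Kept from unfolding to a Boolean expression, on which with-abstraction would fail.
  abstract
    arc? : ∀ a b j → Dec (Arc a b j)
    arc? a b j = (a Fin.≤? b ×-dec a Fin.≤? j ×-dec j Fin.≤? b) ⊎-dec
                 (b Fin.<? a ×-dec (a Fin.≤? j ⊎-dec j Fin.≤? b))

  Arc-start : ∀ a b → Arc a b a
  Arc-start a b with a Fin.≤? b
  ... | yes a≤b = inj₁ (a≤b , ℕ.≤-refl , a≤b)
  ... | no  a≰b = inj₂ (ℕ.≰⇒> a≰b , inj₁ ℕ.≤-refl)

  -- An arc is left only after its end `b`. The second conclusion matters when the arc is the whole
  -- cycle: it does not return to `a` before passing `b`.
  Arc-successor : ∀ {a b j j′} → Successor n j j′ → Arc a b j → j ≢ b → Arc a b j′ × j′ ≢ a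
  Arc-successor {a} {b} {j} {j′} s arc j≢b = go s arc
    where
    below : j Fin.≤ b → j Fin.< b
    below j≤b = ℕ.≤∧≢⇒< j≤b (j≢b ∘ Fin.toℕ-injective)
    above : toℕ j′ ≡ suc (toℕ j) → a Fin.≤ j → a Fin.< j′
    above e a≤j = subst (toℕ a <_) (sym e) (s≤s a≤j)
    go : Successor n j j′ → Arc a b j → Arc a b j′ × j′ ≢ a
    go (inj₁ e) (inj₁ (a≤b , a≤j , j≤b)) =
      inj₁ (a≤b , ℕ.<⇒≤ (above e a≤j) , subst (_≤ toℕ b) (sym e) (below j≤b)) ,
      Fin.<⇒≢ (above e a≤j) ∘ sym
    go (inj₁ e) (inj₂ (b<a , inj₁ a≤j)) =
      inj₂ (b<a , inj₁ (ℕ.<⇒≤ (above e a≤j))) , Fin.<⇒≢ (above e a≤j) ∘ sym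
    go (inj₁ e) (inj₂ (b<a , inj₂ j≤b)) = inj₂ (b<a , inj₂ j′≤b) , Fin.<⇒≢ (ℕ.≤-<-trans j′≤b b<a)
      where
      j′≤b : j′ Fin.≤ b
      j′≤b = subst (_≤ toℕ b) (sym e) (below j≤b)
    go (inj₂ (e , _)) (inj₁ (_ , _ , j≤b)) =
      ⊥-elim (ℕ.<⇒≱ (Fin.toℕ<n b) (subst (_≤ toℕ b) e (below j≤b)))
    go (inj₂ (e , _)) (inj₂ (_ , inj₂ j≤b)) =
      ⊥-elim (ℕ.<⇒≱ (Fin.toℕ<n b) (subst (_≤ toℕ b) e (below j≤b)))
    go (inj₂ (_ , z)) (inj₂ (b<a , inj₁ _)) = inj₂ (b<a , inj₂ j′≤b) , Fin.<⇒≢ (ℕ.≤-<-trans j′≤b b<a)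
      where
      j′≤b : j′ Fin.≤ b
      j′≤b = subst (_≤ toℕ b) (sym z) z≤n

  -- An arc is entered only at its start `a`.
  Arc-predecessor : ∀ {a b j j′} → Successor n j j′ → Arc a b j′ → j′ ≢ a → Arc a b j
  Arc-predecessor {a} {b} {j} {j′} s arc j′≢a = go s arc
    where
    above : toℕ j′ ≡ suc (toℕ j) → a Fin.≤ j′ → a Fin.≤ j
    above e a≤j′ = ℕ.s≤s⁻¹ (subst (toℕ a <_) e (ℕ.≤∧≢⇒< a≤j′ (j′≢a ∘ sym ∘ Fin.toℕ-injective)))
    below : toℕ j′ ≡ suc (toℕ j) → j′ Fin.≤ b → j Fin.≤ b
    below e j′≤b = ℕ.<⇒≤ (subst (_≤ toℕ b) e j′≤b)
    start : toℕ j′ ≡ 0 → ¬ (a Fin.≤ j′)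
    start z a≤j′ = j′≢a (Fin.toℕ-injective
      (trans z (sym (ℕ.n≤0⇒n≡0 (subst (toℕ a ≤_) z a≤j′)))))
    go : Successor n j j′ → Arc a b j′ → Arc a b j
    go (inj₁ e) (inj₁ (a≤b , a≤j′ , j′≤b)) = inj₁ (a≤b , above e a≤j′ , below e j′≤b)
    go (inj₁ e) (inj₂ (b<a , inj₁ a≤j′))   = inj₂ (b<a , inj₁ (above e a≤j′))
    go (inj₁ e) (inj₂ (b<a , inj₂ j′≤b))   = inj₂ (b<a , inj₂ (below e j′≤b))
    go (inj₂ (_ , z)) (inj₁ (_ , a≤j′ , _))    = ⊥-elim (start z a≤j′)
    go (inj₂ (_ , z)) (inj₂ (_ , inj₁ a≤j′))   = ⊥-elim (start z a≤j′)
    -- Here `j` is the last position, so it lies in the upper piece of the wrapped arc.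
    go (inj₂ (e , _)) (inj₂ (b<a , inj₂ _))    =
      inj₂ (b<a , inj₁ (ℕ.s≤s⁻¹ (subst (toℕ a <_) (sym e) (Fin.toℕ<n a))))

-- Even wheels: the two parity classes of triangles.

module EvenWheel {m : ℕ} (3≤n : 3 ≤ suc m * 2) where

  open Wheel 3≤n

  even odd : Fin (suc m) → Fin (suc m * 2)
  even j = combine j zero
  odd  j = combine j (suc zero)

  toℕ-even : ∀ j → toℕ (even j) ≡ 2 * toℕ j
  toℕ-even j = trans (Fin.toℕ-combine j zero) (ℕ.+-identityʳ _)

  toℕ-odd : ∀ j → toℕ (odd j) ≡ suc (2 * toℕ j)
  toℕ-odd j = trans (Fin.toℕ-combine j (suc zero)) (ℕ.+-comm _ 1)

  next-even : ∀ j → next (even j) ≡ odd j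
  next-even j = Successor-functional (next-Successor (even j))
    (inj₁ (trans (toℕ-odd j) (cong suc (sym (toℕ-even j)))))

  next-odd : ∀ j → next (odd j) ≡ even (next j)
  next-odd j = Successor-functional (next-Successor (odd j)) (double (next-Successor j))
    where
    double : ∀ {j′} → Successor (suc m) j j′ → Successor (suc m * 2) (odd j) (even j′)
    double {j′} s rewrite toℕ-even j′ | toℕ-odd j | ℕ.*-comm (suc m) 2 with s
    ... | inj₁ e       rewrite e = inj₁ (ℕ.*-suc 2 (toℕ j))
    ... | inj₂ (e , z) rewrite z = inj₂ (trans (sym (ℕ.*-suc 2 (toℕ j))) (cong (2 *_) e) , refl)

  even≢odd : ∀ i j → even i ≢ odd j
  even≢odd i j eq = case Fin.combine-injectiveʳ i zero j (suc zero) eq of λ ()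

  parity-cases : (P : Fin (suc m * 2) → Set) → (∀ j → P (even j)) → (∀ j → P (odd j)) → ∀ v → P v
  parity-cases P pe po v with Fin.combine-surjective {suc m} {2} v
  ... | j , zero     , refl = pe j
  ... | j , suc zero , refl = po j

  -- Both alternatives hold only for the constantly negative vector, the one overlap in the final
  -- count.
  Alternating : (Fin (suc m * 2) → Sign) → Set
  Alternating t = (∀ j → t (even j) ≡ Sign.-) ⊎ (∀ j → t (odd j) ≡ Sign.-)

  alternating-or-positive : ∀ t →
    Alternating t ⊎ ((∃ λ a → t (even a) ≡ Sign.+) × (∃ λ b → t (odd b) ≡ Sign.+))
  alternating-or-positive t
    with Fin.all? (λ j → t (even j) Sign.≟ Sign.-) | Fin.all? (λ j → t (odd j) Sign.≟ Sign.-)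
  ... | yes p | _     = inj₁ (inj₁ p)
  ... | no _  | yes q = inj₁ (inj₂ q)
  ... | no ¬p | no ¬q = inj₂
    ( map₂ ≢-⇒≡+ (Fin.¬∀⟶∃¬ _ _ (λ j → t (even j) Sign.≟ Sign.-) ¬p)
    , map₂ ≢-⇒≡+ (Fin.¬∀⟶∃¬ _ _ (λ j → t (odd j) Sign.≟ Sign.-) ¬q))

  -- `next` changes the parity, so the `suc m` triangles of one class have no rim vertex in common.
  alternating⇒≤ : ∀ σ → Alternating (triangleSign σ) →
    ∀ l → BalancedByDeleting G σ l → suc m ≤ l
  alternating⇒≤ σ (inj₁ negative) _ (D , _ , refl , balanced) =
    disjointNegativeTriangles⇒≤ σ D balanced even
      (λ {i} {j} → Fin.combine-injectiveˡ i zero j zero)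
      (λ i j eq → even≢odd i j (trans eq (next-even j))) negative
  alternating⇒≤ σ (inj₂ negative) _ (D , _ , refl , balanced) =
    disjointNegativeTriangles⇒≤ σ D balanced odd
      (λ {i} {j} → Fin.combine-injectiveˡ i (suc zero) j (suc zero))
      (λ i j eq → even≢odd (next j) i (sym (trans eq (next-odd j)))) negative

  module _ (σ : Signature G) where

    private
      t : Fin (suc m * 2) → Sign
      t = triangleSign σ

    -- Rim vertices are addressed by half index and parity. An even triangle joins the two vertices
    -- of one index, an odd one passes to the next index, which splits the alternation condition in
    -- two.
    deletingAtPairs : (M : Fin (suc m) → Fin 2 → Bool) (L : List (Fin (suc m * 2))) →
      (∀ j b → M j b ≡ true → combine j b ∈ L) →
      (∀ j → M j (suc zero) ≡ not (M j zero) ⊎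
             (M j zero ≡ false × M j (suc zero) ≡ false × t (even j) ≡ Sign.+)) →
      (∀ j → M (next j) zero ≡ not (M j (suc zero)) ⊎
             (M j (suc zero) ≡ false × M (next j) zero ≡ false × t (odd j) ≡ Sign.+)) →
      ∃ λ l → l ≤ length L × BalancedByDeleting G σ l
    deletingAtPairs M L M⊆L evens odds = deletingAt σ M′ L M′⊆L
      (parity-cases (λ v → Alternates v (next v)) onEven onOdd)
      where
      M′ : Fin (suc m * 2) → Bool
      M′ v = M (proj₁ (remQuot {suc m} 2 v)) (proj₂ (remQuot {suc m} 2 v))
      Alternates : Fin (suc m * 2) → Fin (suc m * 2) → Set
      Alternates v w = M′ w ≡ not (M′ v) ⊎ (M′ v ≡ false × M′ w ≡ false × t v ≡ Sign.+)
      M′-combine : ∀ j b → M′ (combine j b) ≡ M j b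
      M′-combine j b = cong (λ (i , c) → M i c) (Fin.remQuot-combine j b)
      M′⊆L : ∀ v → M′ v ≡ true → v ∈ L
      M′⊆L v Mv = subst (_∈ L) (Fin.combine-remQuot {suc m} 2 v) (M⊆L _ _ Mv)
      transport : ∀ {a a′ b b′ : Bool} {P : Set} → a′ ≡ a → b′ ≡ b →
        b ≡ not a ⊎ (a ≡ false × b ≡ false × P) → b′ ≡ not a′ ⊎ (a′ ≡ false × b′ ≡ false × P)
      transport refl refl p = p
      onEven : ∀ j → Alternates (even j) (next (even j))
      onEven j = subst (Alternates (even j)) (sym (next-even j))
        (transport (M′-combine j zero) (M′-combine j (suc zero)) (evens j))
      onOdd : ∀ j → Alternates (odd j) (next (odd j))
      onOdd j = subst (Alternates (odd j)) (sym (next-odd j))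
        (transport (M′-combine j (suc zero)) (M′-combine (next j) zero) (odds j))

    -- Every triangle has exactly one even rim vertex, so the even vertices serve as `M`.
    deletingHalf : ∃ λ l → l ≤ suc m × BalancedByDeleting G σ l
    deletingHalf = subst (λ b → ∃ λ l → l ≤ b × BalancedByDeleting G σ l) length-L
      (deletingAtPairs M L M⊆L (λ _ → inj₁ refl) (λ _ → inj₁ refl))
      where
      M : Fin (suc m) → Fin 2 → Bool
      M _ zero    = true
      M _ (suc _) = false
      L : List (Fin (suc m * 2))
      L = map even (allFin (suc m))
      M⊆L : ∀ j b → M j b ≡ true → combine j b ∈ L
      M⊆L j zero _ = ∈-map⁺ even (∈-allFin j)
      length-L : length L ≡ suc m
      length-L = trans (List.length-map even (allFin (suc m))) (List.length-tabulate {n = suc m} (λ i → i))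

    -- The positive triangles at even a and odd b cut the rim into two runs of triangles of even
    -- length; grouping each run into pairs of neighbours costs one edge per pair.
    deletingLess : ∀ {a b} → t (even a) ≡ Sign.+ → t (odd b) ≡ Sign.+ →
      ∃ λ l → l ≤ m × BalancedByDeleting G σ l
    deletingLess {a} {b} ta tb = subst (λ c → ∃ λ l → l ≤ c × BalancedByDeleting G σ l) length-L
      (deletingAtPairs M L M⊆L evens odds)
      where
      side : Fin 2 → Bool → Bool
      side zero    = λ p → p
      side (suc _) = not
      -- Even vertices are chosen on the arc from `a` to `b`, odd ones off it, and none of index
      -- `a`: one vertex for each of the other `m` indices.
      M : Fin (suc m) → Fin 2 → Bool
      M j c = not (does (j Fin.≟ a)) ∧ side c (does (arc? a b j))
      sharedVertex : Fin (suc m) → Fin (suc m * 2)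
      sharedVertex j = combine j (if does (arc? a b j) then zero else suc zero)
      L : List (Fin (suc m * 2))
      -- `punchIn a` enumerates the indices other than `a`, which saves the one edge.
      L = map sharedVertex (map (punchIn a) (allFin m))
      length-L : length L ≡ m
      length-L = trans (List.length-map sharedVertex (map (punchIn a) (allFin m)))
        (trans (List.length-map (punchIn a) (allFin m)) (List.length-tabulate {n = m} (λ i → i)))
      sharedVertex∈L : ∀ {j} → a ≢ j → sharedVertex j ∈ L
      sharedVertex∈L a≢j = ∈-map⁺ sharedVertex (subst (_∈ map (punchIn a) (allFin m))
        (Fin.punchIn-punchOut a≢j) (∈-map⁺ (punchIn a) (∈-allFin (punchOut a≢j))))
      M⊆L : ∀ j c → M j c ≡ true → combine j c ∈ L
      M⊆L j c Mj with j Fin.≟ a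
      ... | no j≢a with does (arc? a b j) | sharedVertex∈L (j≢a ∘ sym) | c
      ...   | true  | j∈L | zero     = j∈L
      ...   | false | j∈L | suc zero = j∈L
      evens : ∀ j → M j (suc zero) ≡ not (M j zero) ⊎
        (M j zero ≡ false × M j (suc zero) ≡ false × t (even j) ≡ Sign.+)
      evens j with j Fin.≟ a
      ... | yes refl = inj₂ (refl , refl , ta)
      ... | no _     = inj₁ refl
      odds : ∀ j → M (next j) zero ≡ not (M j (suc zero)) ⊎
        (M j (suc zero) ≡ false × M (next j) zero ≡ false × t (odd j) ≡ Sign.+)
      -- The arc is left only after `b`, where the odd triangle is positive, and entered only at
      -- `a`, whose vertices are not in `M`. In all other cases `j` and `next j` lie on the same
      -- side, and membership alternates.
      odds j with j Fin.≟ b | arc? a b j | j Fin.≟ a | next j Fin.≟ a | arc? a b (next j)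
      ... | no j≢b | yes arc | _ | yes j′≡a | _ =
        ⊥-elim (proj₂ (Arc-successor (next-Successor j) arc j≢b) j′≡a)
      ... | no j≢b | yes arc | _ | _ | no ¬arc =
        ⊥-elim (¬arc (proj₁ (Arc-successor (next-Successor j) arc j≢b)))
      ... | no _ | yes _ | yes _ | no _ | yes _ = inj₁ refl
      ... | no _ | yes _ | no  _ | no _ | yes _ = inj₁ refl
      ... | _ | no ¬arc | yes refl | _ | _ = ⊥-elim (¬arc (Arc-start a b))
      ... | _ | no _ | no _ | yes _ | _ = inj₁ refl
      ... | _ | no ¬arc | no _ | no j′≢a | yes arc =
        ⊥-elim (¬arc (Arc-predecessor (next-Successor j) arc j′≢a))
      ... | _ | no _ | no _ | no _ | no _ = inj₁ refl
      ... | yes refl | yes _ | yes _ | no _  | yes _ = inj₁ refl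
      ... | yes refl | yes _ | no  _ | no _  | yes _ = inj₁ refl
      ... | yes refl | yes _ | yes _ | yes _ | _     = inj₂ (refl , refl , tb)
      ... | yes refl | yes _ | no  _ | yes _ | _     = inj₂ (refl , refl , tb)
      ... | yes refl | yes _ | yes _ | no _  | no _  = inj₂ (refl , refl , tb)
      ... | yes refl | yes _ | no  _ | no _  | no _  = inj₂ (refl , refl , tb)

    alternating⇒isFrustrationIndex : Alternating t → IsFrustrationIndex G σ (suc m)
    alternating⇒isFrustrationIndex alt = attained deletingHalf , alternating⇒≤ σ alt
      where
      -- The deletion found has at most `suc m` edges; the lower bound turns this into equality.
      attained : (∃ λ l → l ≤ suc m × BalancedByDeleting G σ l) → BalancedByDeleting G σ (suc m)
      attained (l , l≤ , balanced) =
        subst (BalancedByDeleting G σ) (ℕ.≤-antisym l≤ (alternating⇒≤ σ alt l balanced)) balanced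

  negative : Signature G
  negative = fromTriangleSigns (const Sign.-)

  -- Attained when all triangles are negative; `deletingHalf` bounds every signature.
  isMaxFrustrationIndex : IsMaxFrustrationIndex G (suc m)
  isMaxFrustrationIndex =
    (negative , alternating⇒isFrustrationIndex negative
      (inj₁ λ j → triangleSign-fromTriangleSigns _ (even j))) ,
    λ { k (σ , _ , minimal) → let l , l≤ , balanced = deletingHalf σ in
        ℕ.≤-trans (minimal l balanced) l≤ }

  alternating⇒maximises : ∀ σ → Alternating (triangleSign σ) → MaximisesFrustration G σ
  alternating⇒maximises σ alt =
    suc m , alternating⇒isFrustrationIndex σ alt , isMaxFrustrationIndex

  -- Otherwise both classes contain a positive triangle, and `deletingLess` brings the index below
  -- the maximum `suc m`.
  maximises⇒alternating : ∀ σ → MaximisesFrustration G σ → Alternating (triangleSign σ)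
  maximises⇒alternating σ (k , (_ , minimal) , (_ , maximal)) =
    [ (λ alt → alt) ,
      (λ ((a , ta) , (b , tb)) → ⊥-elim (tooSmall (deletingLess σ {a} {b} ta tb))) ]′
    (alternating-or-positive (triangleSign σ))
    where
    tooSmall : ¬ (∃ λ l → l ≤ m × BalancedByDeleting G σ l)
    tooSmall (l , l≤ , balanced) = ℕ.<⇒≱ (s≤s (ℕ.≤-trans (minimal l balanced) l≤))
      (maximal (suc m) (proj₁ isMaxFrustrationIndex))

-- Numbering the pairs with a zero coordinate.

module ZeroPairs (p : ℕ) where

  -- The `suc p` pairs with first coordinate zero come first, then the `p` remaining ones, so the
  -- pair of zeros is counted once. The value is meaningful only if some coordinate is zero.
  join-pair : Fin (suc p) → Fin (suc p) → Fin (suc p + p)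
  join-pair zero    b = b Fin.↑ˡ p
  join-pair (suc a) _ = suc p Fin.↑ʳ a

  split-pair : Fin (suc p + p) → Fin (suc p) × Fin (suc p)
  split-pair c = [ (λ b → zero , b) , (λ a → suc a , zero) ]′ (Fin.splitAt (suc p) c)

  split-pair-zero : ∀ (c : Fin (suc p + p)) →
    proj₁ (split-pair c) ≡ zero ⊎ proj₂ (split-pair c) ≡ zero
  split-pair-zero c with Fin.splitAt (suc p) c
  ... | inj₁ _ = inj₁ refl
  ... | inj₂ _ = inj₂ refl

  join-split-pair : ∀ (c : Fin (suc p + p)) →
    join-pair (proj₁ (split-pair c)) (proj₂ (split-pair c)) ≡ c
  join-split-pair c with Fin.splitAt (suc p) c | Fin.join-splitAt (suc p) p c
  ... | inj₁ _ | eq = eq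
  ... | inj₂ _ | eq = eq

  split-join-pair : ∀ (a b : Fin (suc p)) → a ≡ zero ⊎ b ≡ zero →
    split-pair (join-pair a b) ≡ (a , b)
  split-join-pair zero    b _           rewrite Fin.splitAt-↑ˡ (suc p) b p = refl
  split-join-pair (suc a) b (inj₂ refl) rewrite Fin.splitAt-↑ʳ (suc p) p a = refl

-- Numbering the sign vectors, compared pointwise.

funToFin-cong : ∀ {m n} {f g : Fin m → Fin n} → (∀ i → f i ≡ g i) → Fin.funToFin f ≡ Fin.funToFin g
funToFin-cong {zero}  eq = refl
funToFin-cong {suc m} eq = cong₂ combine (eq zero) (funToFin-cong (eq ∘ suc))

toℕ-funToFin-zero : ∀ m {n} → toℕ (Fin.funToFin {m} {suc n} (const zero)) ≡ 0
toℕ-funToFin-zero zero        = refl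
toℕ-funToFin-zero (suc m) {n} = trans
  (Fin.toℕ-combine {suc n} {suc n ^ m} zero (Fin.funToFin {m} {suc n} (const zero)))
  (cong₂ _+_ (ℕ.*-zeroʳ (suc n ^ m)) (toℕ-funToFin-zero m))

-- Sign.- is the digit 0 so that the constantly negative vector gets the number 0.
module SignVectors {m p : ℕ} (size : 2 ^ m ≡ suc p) where

  digit : Sign → Fin 2
  digit Sign.- = zero
  digit Sign.+ = suc zero

  fromDigit : Fin 2 → Sign
  fromDigit zero    = Sign.-
  fromDigit (suc _) = Sign.+

  digit-fromDigit : ∀ d → digit (fromDigit d) ≡ d
  digit-fromDigit zero       = refl
  digit-fromDigit (suc zero) = refl

  fromDigit-digit : ∀ s → fromDigit (digit s) ≡ s
  fromDigit-digit Sign.- = refl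
  fromDigit-digit Sign.+ = refl

  -- Binary numeral of the vector; the cast presents its range as a successor, so that `zero` is a
  -- code.
  encode : (Fin m → Sign) → Fin (suc p)
  encode s = Fin.cast size (Fin.funToFin (digit ∘ s))

  decode : Fin (suc p) → Fin m → Sign
  decode c = fromDigit ∘ Fin.finToFun (Fin.cast (sym size) c)

  encode-cong : ∀ {s s′} → (∀ i → s i ≡ s′ i) → encode s ≡ encode s′
  encode-cong eq = cong (Fin.cast size) (funToFin-cong {m} (cong digit ∘ eq))

  encode-decode : ∀ c → encode (decode c) ≡ c
  encode-decode c = trans
    (cong (Fin.cast size) (trans (funToFin-cong {m} (λ _ → digit-fromDigit _)) (Fin.funToFin-finToFin {m} _)))
    (Fin.cast-involutive size (sym size) c)

  decode-encode : ∀ s i → decode (encode s) i ≡ s i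
  decode-encode s i = trans
    (cong fromDigit (trans (cong (λ c → Fin.finToFun {2} {m} c i) (Fin.cast-involutive (sym size) size _))
                         (Fin.finToFun-funToFin (digit ∘ s) i)))
    (fromDigit-digit (s i))

  encode-negative : ∀ {s} → (∀ i → s i ≡ Sign.-) → encode s ≡ zero
  encode-negative {s} negative = trans (encode-cong negative) (Fin.toℕ-injective
    (trans (Fin.toℕ-cast size _) (toℕ-funToFin-zero m)))

  decode-zero : ∀ {c} → c ≡ zero → ∀ i → decode c i ≡ Sign.-
  decode-zero refl i = trans
    (cong (λ c → decode c i) (sym (encode-negative (λ _ → refl)))) (decode-encode (const Sign.-) i)

-- Counting the maximising switching classes.

module Counting {m p : ℕ} (3≤n : 3 ≤ suc m * 2) (size : 2 ^ suc m ≡ suc p) where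

  open Wheel 3≤n
  open EvenWheel {m} 3≤n
  open ZeroPairs p
  open SignVectors {suc m} size

  code : (Fin (suc m * 2) → Sign) → Fin (suc p + p)
  code t = join-pair (encode (t ∘ even)) (encode (t ∘ odd))

  interleave : (Fin (suc m) → Sign) → (Fin (suc m) → Sign) → Fin (suc m * 2) → Sign
  interleave s s′ v with remQuot {suc m} 2 v
  ... | j , zero  = s j
  ... | j , suc _ = s′ j

  interleave-even : ∀ s s′ j → interleave s s′ (even j) ≡ s j
  interleave-even s s′ j rewrite Fin.remQuot-combine {suc m} {2} j zero = refl

  interleave-odd : ∀ s s′ j → interleave s s′ (odd j) ≡ s′ j
  interleave-odd s s′ j rewrite Fin.remQuot-combine {suc m} {2} j (suc zero) = refl

  uncode : Fin (suc p + p) → Fin (suc m * 2) → Sign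
  uncode c = interleave (decode (proj₁ (split-pair c))) (decode (proj₂ (split-pair c)))

  code-cong : ∀ {t t′} → (∀ v → t v ≡ t′ v) → code t ≡ code t′
  code-cong eq = cong₂ join-pair (encode-cong (eq ∘ even)) (encode-cong (eq ∘ odd))

  uncode-alternating : ∀ c → Alternating (uncode c)
  uncode-alternating c = Sum.map
    (λ z j → trans (interleave-even _ _ j) (decode-zero z j))
    (λ z j → trans (interleave-odd _ _ j) (decode-zero z j))
    (split-pair-zero c)

  code-uncode : ∀ c → code (uncode c) ≡ c
  code-uncode c = trans
    (cong₂ join-pair
      (trans (encode-cong {uncode c ∘ even} {s} (interleave-even s s′)) (encode-decode _))
      (trans (encode-cong {uncode c ∘ odd} {s′} (interleave-odd s s′)) (encode-decode _)))
    (join-split-pair c)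
    where
    s s′ : Fin (suc m) → Sign
    s  = decode (proj₁ (split-pair c))
    s′ = decode (proj₂ (split-pair c))

  -- Alternation makes one of the two codes zero, which is where `join-pair` loses no information.
  uncode-code : ∀ {t} → Alternating t → ∀ v → uncode (code t) v ≡ t v
  uncode-code {t} alt = parity-cases _
    (λ j → trans (interleave-even _ _ j)
      (trans (cong (λ ab → decode (proj₁ ab) j) split) (decode-encode (t ∘ even) j)))
    (λ j → trans (interleave-odd _ _ j)
      (trans (cong (λ ab → decode (proj₂ ab) j) split) (decode-encode (t ∘ odd) j)))
    where
    split : split-pair (code t) ≡ (encode (t ∘ even) , encode (t ∘ odd))
    split = split-join-pair _ _ (Sum.map encode-negative encode-negative alt)

  maximising-count : HasExactly (suc p + p) (maximisingClasses G)
  maximising-count = record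
    { to        = to
    ; from      = from
    ; to-cong   = λ {x} {y} → to-cong {x} {y}
    ; from-cong = λ { {c} refl → Setoid.refl (maximisingClasses G) {from c} }
    ; inverse   = (λ {c} {x} eq → trans (to-cong {x} {from c} eq) (to-from c))
                , λ {x} {c} eq → Setoid.trans (maximisingClasses G) {from c} {from (to x)} {x}
                    (Setoid.reflexive (maximisingClasses G) (cong from eq)) (from-to x)
    }
    where
    Class : Set
    Class = Setoid.Carrier (maximisingClasses G)
    to : Class → Fin (suc p + p)
    to (σ , _) = code (triangleSign σ)
    alternating : ∀ c → Alternating (triangleSign (fromTriangleSigns (uncode c)))
    alternating c = Sum.map
      (λ neg j → trans (triangleSign-fromTriangleSigns (uncode c) (even j)) (neg j))
      (λ neg j → trans (triangleSign-fromTriangleSigns (uncode c) (odd j)) (neg j))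
      (uncode-alternating c)
    from : Fin (suc p + p) → Class
    from c = fromTriangleSigns (uncode c) , alternating⇒maximises (fromTriangleSigns (uncode c)) (alternating c)
    to-cong : ∀ {x y : Class} → proj₁ x ≈ₛ proj₁ y → to x ≡ to y
    to-cong {σ , _} {τ , _} eq = code-cong {triangleSign σ} {triangleSign τ} (triangleSign-cong {σ} {τ} eq)
    to-from : ∀ c → to (from c) ≡ c
    to-from c = trans (code-cong {triangleSign (proj₁ (from c))} {uncode c} (triangleSign-fromTriangleSigns (uncode c))) (code-uncode c)
    from-to : ∀ x → proj₁ (from (to x)) ≈ₛ proj₁ x
    -- Switching equivalence is checked on triangle signs; maximality of `σ` gives the alternation
    -- that decoding requires.
    from-to (σ , max) = triangleSign-injective {fromTriangleSigns t} {σ} λ v →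
      trans (triangleSign-fromTriangleSigns t v) (uncode-code (maximises⇒alternating σ max) v)
      where
      t : Fin (suc m * 2) → Sign
      t = uncode (code (triangleSign σ))

  half-count : suc p + p ≡ 2 ^ (suc m * 2 / 2 + 1) ∸ 1
  half-count = sym (trans
    (cong (λ e → 2 ^ e ∸ 1) (trans (cong (_+ 1) (m*n/n≡m (suc m) 2)) (ℕ.+-comm (suc m) 1)))
    (trans (cong (λ q → 2 * q ∸ 1) size)
      (trans (ℕ.+-suc p (p + 0)) (cong (λ q → suc (p + q)) (ℕ.+-identityʳ p)))))

  maximising-count-power : HasExactly (2 ^ (suc m * 2 / 2 + 1) ∸ 1) (maximisingClasses G)
  maximising-count-power =
    subst (λ c → HasExactly c (maximisingClasses G)) half-count maximising-count

corollary26 : (n : ℕ) (4≤n : 4 ≤ n) → 2 ∣ n →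
    HasExactly (2 ^ (n / 2 + 1) ∸ 1) (maximisingClasses (W n (<⇒≤ 4≤n)))
corollary26 _ ()  (divides zero refl)
-- Here `suc m` is n/2, and `p` counts the sign vectors of that length other than the constantly
-- negative one.
corollary26 _ 4≤n (divides (suc m) refl) =
  Counting.maximising-count-power {m} {ℕ.pred (2 ^ suc m)} (<⇒≤ 4≤n)
  (sym (ℕ.suc-pred (2 ^ suc m) ⦃ ℕ.m^n≢0 2 (suc m) ⦄))
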